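{- For every $\Gamma\cup\{\varphi\}\subseteq For(\Sigma)$, if $\Gamma\vdash_{DmbCcl}\varphi$, then $\Gamma\vDash_{DmbCcl}\varphi$.
   Context: **Syntax.** $For(\Sigma)$ is the set of formulas generated from a denumerable set of propositional variables by the signature $\Sigma=\{\to,\neg,\lor,\land,\mathsf{O},\circ\}$ ($\neg,\mathsf{O},\circ$ unary; $\to,\lor,\land$ binary). **The logic $DmbCcl$.** Hilbert calculus whose axiom schemas are those of $CPL^+$, the positive fragment of classical propositional logic in $\to,\land,\lor$ (for instance: $\alpha\to(\beta\to\alpha)$; $(\alpha\to(\beta\to\gamma))\to((\alpha\to\beta)\to(\alpha\to\gamma))$; $\alpha\to(\beta\to(\alpha\land\beta))$; $(\alpha\land\beta)\to\alpha$; $(\alpha\land\beta)\to\beta$; $\alpha\to(\alpha\lor\beta)$; $\beta\to(\alpha\lor\beta)$; $(\alpha\to\gamma)\to((\beta\to\gamma)\to((\alpha\lor\beta)\to\gamma))$; $\alpha\lor(\alpha\to\beta)$), plus (EM) $\alpha\lor\neg\alpha$; (bc) $\circ\alpha\to(\alpha\to(\neg\alpha\to\beta))$; ($\mathsf{O}$-K) $\mathsf{O}(\alpha\to\beta)\to(\mathsf{O}\alpha\to\mathsf{O}\beta)$; ($\mathsf{O}$-E) $\mathsf{O}\bot_\alpha\to\bot_\alpha$, where $\bot_\alpha:=(\alpha\land\neg\alpha)\land\circ\alpha$; and (cl) $\neg(\alpha\land\neg\alpha)\to\circ\alpha$. The rules are Modus Ponens and $\mathsf{O}$-necessitation (from $\varphi$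 infer $\mathsf{O}\varphi$). $\vdash_{DmbCcl}\varphi$ means that there is a finite derivation of $\varphi$ from axioms (no premises) using the rules. $\Gamma\vdash_{DmbCcl}\varphi$ means: either $\vdash_{DmbCcl}\varphi$, or there are $\gamma_1,\dots,\gamma_k\in\Gamma$ ($k\ge 1$ finite) with $\vdash_{DmbCcl}(\gamma_1\land\dots\land\gamma_k)\to\varphi$. **Semantics.** Let $A=\{T,t,F\}$ with $T=(1,0)$, $t=(1,1)$, $F=(0,1)$; for $a\in A$ write $a=(a_1,a_2)$. Designated values: $\mathcal{D}=\{T,t\}$. Let $\sqcap,\sqcup,\supset,{\sim}$ be the Boolean meet, join, implication and complement on $\{0,1\}$, and $\bigwedge$ the meet of a non-empty subset. For $a,b\in A$, $\emptyset\neq X\subseteq A$: - $a\,\tilde\land\,b=\{c\in A: c_1=a_1\sqcap b_1\}$; $a\,\tilde\lor\,b=\{c\in A: c_1=a_1\sqcup b_1\}$; $a\,\tilde\to\,b=\{c\in A: c_1=a_1\supset b_1\}$; - $\tilde\neg a=\{c\in A: c_1=a_2\}$; $\tilde\circ_1 a=\{c\in A: c_1={\sim}(a_1\sqcap a_2)\}$; - $\tilde{\mathsf{O}}(X)=\{c\in A: c_1=\bigwedge\{x_1:x\in X\}\}$. A swap Kripke model for $DmbCcl$ is a triple $\langle W,R,\{v_w\}_{w\in W}\rangle$ where $W\ne\emptyset$, $R\subseteq W^2$ is serial (every $w$ has some $w'$ with $wRw'$), and each $v_w:For(\Sigma)\to A$ satisfies, for all $\alpha,\beta$: $v_w(\alpha\#\beta)\in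 v_w(\alpha)\,\tilde\#\,v_w(\beta)$ for $\#\in\{\land,\lor,\to\}$; $v_w(\neg\alpha)\in\tilde\neg v_w(\alpha)$; $v_w(\circ\alpha)\in\tilde\circ_1 v_w(\alpha)$; $v_w(\mathsf{O}\alpha)\in\tilde{\mathsf{O}}(\{v_{w'}(\alpha): wRw'\})$; and, in addition, if $v_w(\alpha)=t$ then $v_w(\alpha\land\neg\alpha)=T$. $\mathcal{M},w\vDash\alpha$ means $v_w(\alpha)\in\mathcal{D}$; $\mathcal{M},w\vDash\Gamma$ means $\mathcal{M},w\vDash\gamma$ for all $\gamma\in\Gamma$. $\Gamma\vDash_{DmbCcl}\alpha$ means: for every swap Kripke model $\mathcal{M}$ for $DmbCcl$ and every world $w$ of it, $\mathcal{M},w\vDash\Gamma$ implies $\mathcal{M},w\vDash\alpha$. -}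

module Defs where

open import Data.Bool.Base using (Bool; true; false; not; _∧_; _∨_; _≤_)
open import Data.List.NonEmpty.Base using (List⁺; foldl₁)
open import Data.List.NonEmpty.Relation.Unary.All using (All)
open import Data.Nat.Base using (ℕ)
open import Data.Product.Base using (∃-syntax; _×_)
open import Data.Sum.Base using (_⊎_)
open import Level using (Level; 0ℓ; _⊔_; suc)
open import Relation.Binary.Core using (Rel)
open import Relation.Binary.PropositionalEquality.Core using (_≡_)
open import Relation.Unary using (Pred; _∈_)

infixr 9 `¬_ `O_ `∘_
infixr 7 _`∧_
infixr 6 _`∨_
infixr 5 _`→_

data For : Set where
  var              : ℕ → For
  _`→_ _`∧_ _`∨_   : For → For → For
  `¬_ `O_ `∘_      : For → For

`⊥ : For → For
`⊥ α = (α `∧ `¬ α) `∧ `∘ α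

data Axiom : Pred For 0ℓ where
  K       : ∀ α β   → Axiom (α `→ (β `→ α))
  S       : ∀ α β γ → Axiom ((α `→ (β `→ γ)) `→ ((α `→ β) `→ (α `→ γ)))
  ∧-intro : ∀ α β   → Axiom (α `→ (β `→ (α `∧ β)))
  ∧-elim₁ : ∀ α β   → Axiom ((α `∧ β) `→ α)
  ∧-elim₂ : ∀ α β   → Axiom ((α `∧ β) `→ β)
  ∨-intro₁ : ∀ α β  → Axiom (α `→ (α `∨ β))
  ∨-intro₂ : ∀ α β  → Axiom (β `→ (α `∨ β))
  ∨-elim  : ∀ α β γ → Axiom ((α `→ γ) `→ ((β `→ γ) `→ ((α `∨ β) `→ γ)))
  ∨-→     : ∀ α β   → Axiom (α `∨ (α `→ β))
  EM      : ∀ α     → Axiom (α `∨ `¬ α)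
  bc      : ∀ α β   → Axiom (`∘ α `→ (α `→ (`¬ α `→ β)))
  O-K     : ∀ α β   → Axiom (`O (α `→ β) `→ (`O α `→ `O β))
  O-E     : ∀ α     → Axiom (`O (`⊥ α) `→ `⊥ α)
  cl      : ∀ α     → Axiom (`¬ (α `∧ `¬ α) `→ `∘ α)

infix 3 ⊢₀_ _⊢_

data ⊢₀_ : Pred For 0ℓ where
  axiom         : ∀ {φ} → Axiom φ → ⊢₀ φ
  modus-ponens  : ∀ {φ ψ} → ⊢₀ φ `→ ψ → ⊢₀ φ → ⊢₀ ψ
  necessitation : ∀ {φ} → ⊢₀ φ → ⊢₀ `O φ

-- An iterated conjunction without brackets is read as associating to the left.
⋀ᶠ : List⁺ For → For
⋀ᶠ = foldl₁ _`∧_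

-- Premises are discharged through an implication, so necessitation is never
-- applied to a formula that depends on Γ.
_⊢_ : ∀ {g} → Pred For g → For → Set g
Γ ⊢ φ = (⊢₀ φ) ⊎ (∃[ γs ] All Γ γs × (⊢₀ ⋀ᶠ γs `→ φ))

-- T = (1,0), t = (1,1), F = (0,1); the components are given by _₁ and _₂.
data A : Set where
  T t F : A

infix 10 _₁ _₂

_₁ : A → Bool
T ₁ = true
t ₁ = true
F ₁ = false

_₂ : A → Bool
T ₂ = false
t ₂ = true
F ₂ = true

𝒟 : Pred A 0ℓ
𝒟 a = a ≡ T ⊎ a ≡ t

infixr 5 _⊃_

_⊃_ : Bool → Bool → Bool
x ⊃ y = not x ∨ y

-- The meet of an arbitrary set of truth values is given as a relation
-- ("b is the greatest lower bound of X"), since it is not computable as a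
-- function of X.
infix 4 _IsMeetOf_

_IsMeetOf_ : ∀ {ℓ} → Bool → Pred Bool ℓ → Set ℓ
b IsMeetOf X = (∀ x → x ∈ X → b ≤ x)
             × (∀ d → (∀ x → x ∈ X → d ≤ x) → d ≤ b)

infix 8 _∧̃_ _∨̃_ _→̃_

_∧̃_ _∨̃_ _→̃_ : A → A → Pred A 0ℓ
(a ∧̃ b) c = c ₁ ≡ a ₁ ∧ b ₁
(a ∨̃ b) c = c ₁ ≡ a ₁ ∨ b ₁
(a →̃ b) c = c ₁ ≡ (a ₁ ⊃ b ₁)

¬̃ ∘̃₁ : A → Pred A 0ℓ
¬̃ a c = c ₁ ≡ a ₂
∘̃₁ a c = c ₁ ≡ not (a ₁ ∧ a ₂)

-- Only meant for non-empty X; in a model, seriality guarantees this.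
Õ : ∀ {ℓ} → Pred A ℓ → Pred A ℓ
Õ X c = c ₁ IsMeetOf (λ b → ∃[ x ] x ∈ X × b ≡ x ₁)

record SwapKripkeModel (w r : Level) : Set (suc (w ⊔ r)) where
  field
    W        : Set w
    nonempty : W
    R        : Rel W r
    serial   : ∀ u → ∃[ u′ ] R u u′
    v        : W → For → A

  -- { v_u′(α) : u R u′ }
  successorValues : W → For → Pred A (w ⊔ r)
  successorValues u α x = ∃[ u′ ] R u u′ × x ≡ v u′ α

  field
    v-∧  : ∀ u α β → v u (α `∧ β) ∈ (v u α ∧̃ v u β)
    v-∨  : ∀ u α β → v u (α `∨ β) ∈ (v u α ∨̃ v u β)
    v-→  : ∀ u α β → v u (α `→ β) ∈ (v u α →̃ v u β)
    v-¬  : ∀ u α → v u (`¬ α) ∈ ¬̃ (v u α)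
    v-∘  : ∀ u α → v u (`∘ α) ∈ ∘̃₁ (v u α)
    v-O  : ∀ u α → v u (`O α) ∈ Õ (successorValues u α)
    v-cl : ∀ u α → v u α ≡ t → v u (α `∧ `¬ α) ≡ T

infix 3 _∙_⊩_ _∙_⊩ˢ_ _⊨[_,_]_

_∙_⊩_ : ∀ {w r} (M : SwapKripkeModel w r) → SwapKripkeModel.W M → For → Set
M ∙ u ⊩ α = SwapKripkeModel.v M u α ∈ 𝒟

_∙_⊩ˢ_ : ∀ {w r g} (M : SwapKripkeModel w r) → SwapKripkeModel.W M → Pred For g → Set g
M ∙ u ⊩ˢ Γ = ∀ γ → γ ∈ Γ → M ∙ u ⊩ γ

_⊨[_,_]_ : ∀ {g} → Pred For g → (w r : Level) → For → Set (g ⊔ suc (w ⊔ r))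
Γ ⊨[ w , r ] φ =
  ∀ (M : SwapKripkeModel w r) (u : SwapKripkeModel.W M) → M ∙ u ⊩ˢ Γ → M ∙ u ⊩ φ

{-# OPTIONS --safe #-}

-- Soundness by induction on derivations. A value is designated exactly when its
-- first component is true, and on first components the connectives →, ∧, ∨ are
-- the classical ones while O is quantification over successors. The second
-- component matters only for EM, bc, O-E and cl; in cl, the extra model
-- condition makes ¬(α ∧ ¬α) false whenever α takes the value t.
module Submission where

open import Data.Bool.Base using (true; false; _∧_; _∨_; not; _≤_; b≤b)
open import Data.List.Base using (foldl)
open import Data.List.NonEmpty.Base using (_∷_)
open import Data.List.NonEmpty.Relation.Unary.All using (_∷_)
open import Data.List.Relation.Unary.All as All using (All; []; _∷_)
open import Data.Product.Base using (_×_; _,_; proj₁; proj₂)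
open import Data.Sum.Base using (_⊎_; inj₁; inj₂; [_,_]′)
open import Defs
open import Level using (Level)
open import Relation.Binary.PropositionalEquality
  using (_≡_; refl; sym; trans; cong; cong₂; subst)
open import Relation.Nullary using (¬_; contradiction)
open import Relation.Unary using (Pred; _∈_)

true≤⇒≡true : ∀ {b} → true ≤ b → b ≡ true
true≤⇒≡true b≤b = refl

𝒟⇒₁≡true : ∀ {a} → a ∈ 𝒟 → a ₁ ≡ true
𝒟⇒₁≡true (inj₁ refl) = refl
𝒟⇒₁≡true (inj₂ refl) = refl

₁≡true⇒𝒟 : ∀ {a} → a ₁ ≡ true → a ∈ 𝒟
₁≡true⇒𝒟 {T} _ = inj₁ refl
₁≡true⇒𝒟 {t} _ = inj₂ refl

module Soundness {w r : Level} (M : SwapKripkeModel w r) where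
  open SwapKripkeModel M

  infix 4 _⊩_

  -- Designation as an equation in `Bool`: the multivalued clauses fix only first components, so
  -- they can be chained by `trans`.
  _⊩_ : W → For → Set
  u ⊩ α = v u α ₁ ≡ true

  module _ {u : W} where

    →-introˢ : ∀ {α β} → (u ⊩ α → u ⊩ β) → u ⊩ α `→ β
    →-introˢ {α} {β} f = trans (v-→ u α β) (⊃-true f)
      where
      ⊃-true : ∀ {x y} → (x ≡ true → y ≡ true) → (x ⊃ y) ≡ true
      ⊃-true {true}  g = g refl
      ⊃-true {false} _ = refl

    →-elimˢ : ∀ {α β} → u ⊩ α `→ β → u ⊩ α → u ⊩ β
    →-elimˢ {α} {β} h a = trans (cong (_⊃ v u β ₁) (sym a)) (trans (sym (v-→ u α β)) h)

    ∧-introˢ : ∀ {α β} → u ⊩ α → u ⊩ β → u ⊩ α `∧ β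
    ∧-introˢ {α} {β} a b = trans (v-∧ u α β) (cong₂ _∧_ a b)

    ∧-elimˢ : ∀ {α β} → u ⊩ α `∧ β → u ⊩ α × u ⊩ β
    ∧-elimˢ {α} {β} h = ∧-true (trans (sym (v-∧ u α β)) h)
      where
      ∧-true : ∀ {x y} → x ∧ y ≡ true → x ≡ true × y ≡ true
      ∧-true {true} q = refl , q

    ∨-intro₁ˢ : ∀ {α β} → u ⊩ α → u ⊩ α `∨ β
    ∨-intro₁ˢ {α} {β} a = trans (v-∨ u α β) (cong (_∨ v u β ₁) a)

    ∨-intro₂ˢ : ∀ {α β} → u ⊩ β → u ⊩ α `∨ β
    ∨-intro₂ˢ {α} {β} b = trans (v-∨ u α β) (∨-true b)
      where
      ∨-true : ∀ {x y} → y ≡ true → x ∨ y ≡ true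
      ∨-true {true}  _ = refl
      ∨-true {false} q = q

    ∨-elimˢ : ∀ {α β} → u ⊩ α `∨ β → u ⊩ α ⊎ u ⊩ β
    ∨-elimˢ {α} {β} h = ∨-true (trans (sym (v-∨ u α β)) h)
      where
      ∨-true : ∀ {x y} → x ∨ y ≡ true → x ≡ true ⊎ y ≡ true
      ∨-true {true}  _ = inj₁ refl
      ∨-true {false} q = inj₂ q

    ∨-→ˢ : ∀ α β → u ⊩ α `∨ (α `→ β)
    ∨-→ˢ α β with v u α ₁ in eq
    ... | true  = ∨-intro₁ˢ eq
    ... | false = ∨-intro₂ˢ (→-introˢ λ a → contradiction (trans (sym eq) a) λ ())

    -- No value has both components false: `F`, the only one with first component `false`, has
    -- second component `true`.
    EMˢ : ∀ α → u ⊩ α `∨ `¬ α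
    EMˢ α with v u α in eq
    ... | T = ∨-intro₁ˢ (cong _₁ eq)
    ... | t = ∨-intro₁ˢ (cong _₁ eq)
    ... | F = ∨-intro₂ˢ (trans (v-¬ u α) (cong _₂ eq))

    -- If α and ¬α both hold, both components of the value of α are `true`, and then `v-∘` makes ∘α
    -- false.
    gentle-explosion : ∀ {α} → u ⊩ `∘ α → u ⊩ α → ¬ u ⊩ `¬ α
    gentle-explosion {α} c a n
      with () ← trans (sym c) (trans (v-∘ u α)
                  (cong not (cong₂ _∧_ a (trans (sym (v-¬ u α)) n))))

    ⊥-unsatisfiable : ∀ {α} → ¬ u ⊩ `⊥ α
    ⊥-unsatisfiable h =
      let (αn , c) = ∧-elimˢ h
          (a , n)  = ∧-elimˢ αn
      in gentle-explosion c a n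

    clˢ : ∀ {α} → u ⊩ `¬ (α `∧ `¬ α) → u ⊩ `∘ α
    clˢ {α} h with v u α in eq
    -- The components of `T` and of `F` are complementary, so their meet is `false`.
    ... | T = trans (v-∘ u α) (cong (λ a → not (a ₁ ∧ a ₂)) eq)
    ... | F = trans (v-∘ u α) (cong (λ a → not (a ₁ ∧ a ₂)) eq)
    -- The value `T` given by `v-cl` has second component `false`, so `v-¬` contradicts `h`.
    ... | t with () ← trans (sym h) (trans (v-¬ u (α `∧ `¬ α)) (cong _₂ (v-cl u α eq)))

    -- `true` is a lower bound of the successors' first components, hence lies below their greatest
    -- lower bound.
    O-introˢ : ∀ {α} → (∀ u′ → R u u′ → u′ ⊩ α) → u ⊩ `O α
    O-introˢ {α} h = true≤⇒≡true (proj₂ (v-O u α) true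
      λ { _ (_ , (u′ , Ruu′ , refl) , refl) → subst (true ≤_) (sym (h u′ Ruu′)) b≤b })

    O-elimˢ : ∀ {α} → u ⊩ `O α → ∀ {u′} → R u u′ → u′ ⊩ α
    O-elimˢ {α} h {u′} Ruu′ = true≤⇒≡true (subst (_≤ v u′ α ₁) h
      (proj₁ (v-O u α) _ (_ , (u′ , Ruu′ , refl) , refl)))

  axiom-sound : ∀ {φ} → Axiom φ → ∀ u → u ⊩ φ
  axiom-sound (K α β)        u = →-introˢ λ a → →-introˢ λ _ → a
  axiom-sound (S α β γ)      u = →-introˢ λ f → →-introˢ λ g → →-introˢ λ a →
                                   →-elimˢ (→-elimˢ f a) (→-elimˢ g a)
  axiom-sound (∧-intro α β)  u = →-introˢ λ a → →-introˢ λ b → ∧-introˢ a b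
  axiom-sound (∧-elim₁ α β)  u = →-introˢ λ h → proj₁ (∧-elimˢ h)
  axiom-sound (∧-elim₂ α β)  u = →-introˢ λ h → proj₂ (∧-elimˢ h)
  axiom-sound (∨-intro₁ α β) u = →-introˢ ∨-intro₁ˢ
  axiom-sound (∨-intro₂ α β) u = →-introˢ ∨-intro₂ˢ
  axiom-sound (∨-elim α β γ) u = →-introˢ λ f → →-introˢ λ g → →-introˢ λ h →
                                   [ →-elimˢ f , →-elimˢ g ]′ (∨-elimˢ h)
  axiom-sound (∨-→ α β)      u = ∨-→ˢ α β
  axiom-sound (EM α)         u = EMˢ α
  axiom-sound (bc α β)       u = →-introˢ λ c → →-introˢ λ a → →-introˢ λ n →
                                   contradiction n (gentle-explosion c a)
  axiom-sound (O-K α β)      u = →-introˢ λ f → →-introˢ λ a → O-introˢ λ _ Ruu′ →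
                                   →-elimˢ (O-elimˢ f Ruu′) (O-elimˢ a Ruu′)
  -- Seriality supplies a successor, where the bottom formula would have to hold.
  axiom-sound (O-E α)        u = →-introˢ λ h →
                                   contradiction (O-elimˢ h (proj₂ (serial u))) ⊥-unsatisfiable
  axiom-sound (cl α)         u = →-introˢ clˢ

  -- The induction must cover all worlds at once: necessitation at `u` uses its premise at the
  -- successors of `u`.
  ⊢₀-sound : ∀ {φ} → ⊢₀ φ → ∀ u → u ⊩ φ
  ⊢₀-sound (axiom a)          u = axiom-sound a u
  ⊢₀-sound (modus-ponens d e) u = →-elimˢ (⊢₀-sound d u) (⊢₀-sound e u)
  ⊢₀-sound (necessitation d)  u = O-introˢ λ u′ _ → ⊢₀-sound d u′

  -- Stated for an arbitrary accumulator `α`, since each step of the left fold replaces it by a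
  -- longer conjunction.
  foldl-∧-introˢ : ∀ {u α αs} → u ⊩ α → All (u ⊩_) αs → u ⊩ foldl _`∧_ α αs
  foldl-∧-introˢ a []       = a
  foldl-∧-introˢ a (b ∷ bs) = foldl-∧-introˢ (∧-introˢ a b) bs

theorem4p5 : ∀ {g w r : Level} (Γ : Pred For g) (φ : For) → Γ ⊢ φ → Γ ⊨[ w , r ] φ
theorem4p5 Γ φ (inj₁ d) M u _ = ₁≡true⇒𝒟 (⊢₀-sound d u)
  where open Soundness M
theorem4p5 Γ φ (inj₂ (_ , p ∷ ps , d)) M u u⊩Γ =
  -- `d` is premise-free and so holds at `u`; detaching there uses Γ at `u` only.
  ₁≡true⇒𝒟 (→-elimˢ (⊢₀-sound d u) (foldl-∧-introˢ (⊩Γ p) (All.map ⊩Γ ps)))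
  where
  open Soundness M
  ⊩Γ : ∀ {γ} → γ ∈ Γ → u ⊩ γ
  ⊩Γ {γ} γ∈Γ = 𝒟⇒₁≡true (u⊩Γ γ γ∈Γ)
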